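{- Let $n\ge1$, let $T\in\mathcal P_n$ be a plane tree with $n$ edges and let $\tilde T=\tilde\phi(T)$. For any node $v$ of $T$, if $v\leadsto u$ (in $T$), then $$(\mathsf{lsw},\mathsf{lev},\mathsf{rsw},\widetilde{\mathsf{rsw}})_{T}(v)=(\mathsf{lev},\mathsf{lsw},\widetilde{\mathsf{rsw}},\mathsf{rsw})_{\tilde T}(u).$$
   Context: **Plane trees.** A plane tree is a rooted tree in which the children of each node are linearly ordered (left to right). $\mathcal{P}_n$ is the set of plane trees with $n\ge1$ edges. A node without children is a leaf; otherwise it is internal. The nodes of $T\in\mathcal P_n$ are named $0,1,\dots,n$ (only to distinguish them), the root being $0$ and the leftmost child of the root being $1$. Nodes with the same parent are siblings; siblings to the left of a node are elder, those to the right are younger; the eldest child of a node is its leftmost child. **Binary trees and the involution $\tilde\phi$.** A binary tree is a rooted tree in which each node has at most one left child and at most one right child; $\mathcal{B}_n$ is the set of binary trees with $n$ nodes. The bijection $\varphi:\mathcal P_n\to\mathcal B_n$: the nodes of $\varphi(T)$ are the non-root nodes of $T$; its root is the leftmost child of the root of $T$; for non-root nodes $x,y$ of $T$, $y$ is the left child of $x$ in $\varphi(T)$ iff $y$ is the leftmost child of $x$ in $T$, and $y$ is the right child of $x$ in $\varphi(T)$ iff $x$ is the closest elder sibling of $y$ in $T$. For $B\in\mathcal B_n$, $\phi(B)$ is the mirror image of $B$ (same nodes, left and right children exchanged). Put $\tilde\phi=\varphi^{ -1}\circ\phi\circ\varphi:\mathcal P_n\to\mathcal P_n$. Node names are kept,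 so $T$ and $\tilde\phi(T)$ have the same node set, both with root $0$. **Complement and the relation $\leadsto$.** Let $B=\varphi(T)$. Add new nodes to $B$ so that every node of $B$ has exactly two children; the result is the complement $\overline B$. The added nodes are named $0',1',\dots,n'$: if the added node is a left child of a node $v$ of $B$, it is named $v'$; if it is a right child of a node $v$ of $B$, it is named $u'$, where $u$ is the parent of $v$ in $T$. Define $\overline{\phi(B)}$ in the same way using $\tilde\phi(T)$ in place of $T$. For every node $v$ of $T$ there is a unique node $u$ of $T$ such that either $v'$ is the right child of $u$ in $\overline B$, or $u'$ is the right child of $v$ in $\overline{\phi(B)}$; one writes $v\leadsto u$. **Statistics of a node $v$ of a plane tree $T$.** - $\mathsf{lev}_T(v)$: number of edges on the path from $v$ to the root. - $\mathsf{Lc}_T(v)$: the set of nodes attached to nodes other than $v$ on the path from $v$ to the root from the left-hand side, i.e. the set of all elder siblings of the non-root nodes on this path ($v$ included). - $\mathsf{lsw}_T(v)$ (left spanning width): the number of children of $v$ plus $|\mathsf{Lc}_T(v)|$. - $\mathsf{rsw}_T(v)$ (right spanning width): the number of children of $v$ plus the number of edges attached to nodes other than $v$ on the path from $v$ to the root from the right-hand side (i.e. plus the total number of younger siblings of the non-root nodes on this path, $v$ included). - $\mathsf{lchain}_T(v)$: the length (number of edges) of the left chain of $v$, i.e. the path $v=v_1,v_2,\dots,v_k$ where $v_{i+1}$ is the eldest child of $v_i$ and $v_k$ is a leaf. - $\widetilde{\mathsf{deg}}_T(v)$ (dual degree): $0$ if $v$ is internal; $\mathsf{lev}_T(v)$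 if $v$ is a leaf and no node on the path from $v$ to the root has elder siblings; otherwise the number of nodes from $v$ to the first node having elder siblings (both included) when walking from $v$ to the root. - $\widetilde{\mathsf{rsw}}_T(v)=\sum_{w\in \mathsf{Lc}_T(v)\cup\mathsf{Ch}_T(v)}\mathsf{lchain}_T(w)+\widetilde{\mathsf{deg}}_T(v)$ (dual right spanning width), where $\mathsf{Ch}_T(v)$ is the set of children of $v$ in $T$. The displayed equality means equality of the four components in order. -}

module Defs where

open import Data.Fin using (Fin; toℕ)
open import Data.List using (List; []; _∷_; _++_; _∷ʳ_; map; concatMap; length; lookup; take; drop; head; upTo)
open import Data.List.Relation.Binary.Permutation.Propositional
  using (_↭_; prep; ↭-refl; ↭-trans; ↭-reflexive)
open import Data.List.Relation.Binary.Permutation.Propositional.Properties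
  using (++-comm; ++⁺)
open import Data.Maybe using (just)
open import Data.Nat using (ℕ; suc; _+_)
open import Data.Nat.ListAction using (sum)
open import Data.Sum using (_⊎_)
open import Data.Tree.Binary as Binary using (leaf)
open import Data.Unit using (⊤; tt)
open import Relation.Binary.PropositionalEquality using (_≡_; refl; trans; cong; cong₂)

------------------------------------------------------------------------
-- Plane trees

data PlaneTree : Set where
  node : (name : ℕ) (children : List PlaneTree) → PlaneTree

rootName : PlaneTree → ℕ
rootName (node x _) = x

subtrees : PlaneTree → List PlaneTree
subtrees (node _ ts) = ts

mutual
  names : PlaneTree → List ℕ
  names (node x ts) = x ∷ namesᶠ ts

  namesᶠ : List PlaneTree → List ℕ
  namesᶠ []       = []
  namesᶠ (t ∷ ts) = names t ++ namesᶠ ts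

-- n edges means n + 1 nodes; `named` says that 0, …, n are their names, each
-- used exactly once.
record 𝒫 (n : ℕ) : Set where
  field
    tree          : PlaneTree
    named         : names tree ↭ upTo (suc n)
    root-is-0     : rootName tree ≡ 0
    leftmost-is-1 : head (map rootName (subtrees tree)) ≡ just 1

open 𝒫 public

------------------------------------------------------------------------
-- Binary trees and the involution

-- `leaf tt` is not a node: it marks an absent left or right child.
BinaryTree : Set
BinaryTree = Binary.Tree ℕ ⊤

-- The image of a node x has as left child the image of the leftmost child of
-- x, and as right child the image of the next younger sibling of x.
φᶠ : List PlaneTree → BinaryTree
φᶠ []               = leaf tt
φᶠ (node x cs ∷ ts) = Binary.node (φᶠ cs) x (φᶠ ts)

φ : PlaneTree → BinaryTree
φ T = φᶠ (subtrees T)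

φᶠ⁻¹ : BinaryTree → List PlaneTree
φᶠ⁻¹ (leaf tt)           = []
φᶠ⁻¹ (Binary.node l x r) = node x (φᶠ⁻¹ l) ∷ φᶠ⁻¹ r

φ⁻¹ : BinaryTree → PlaneTree
φ⁻¹ B = node 0 (φᶠ⁻¹ B)

mirror : BinaryTree → BinaryTree
mirror (leaf tt)           = leaf tt
mirror (Binary.node l x r) = Binary.node (mirror r) x (mirror l)

φᶠ⁻¹∘φᶠ : ∀ ts → φᶠ⁻¹ (φᶠ ts) ≡ ts
φᶠ⁻¹∘φᶠ []               = refl
φᶠ⁻¹∘φᶠ (node x cs ∷ ts) = cong₂ (λ c t → node x c ∷ t) (φᶠ⁻¹∘φᶠ cs) (φᶠ⁻¹∘φᶠ ts)

φ⁻¹∘φ : ∀ T → rootName T ≡ 0 → φ⁻¹ (φ T) ≡ T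
φ⁻¹∘φ (node .0 ts) refl = cong (node 0) (φᶠ⁻¹∘φᶠ ts)

φ∘φ⁻¹ : ∀ B → φ (φ⁻¹ B) ≡ B
φ∘φ⁻¹ (leaf tt)           = refl
φ∘φ⁻¹ (Binary.node l x r) = cong₂ (λ a b → Binary.node a x b) (φ∘φ⁻¹ l) (φ∘φ⁻¹ r)

-- The tree underlying the involution, which keeps the names of all nodes.
φ̃-tree : PlaneTree → PlaneTree
φ̃-tree T = φ⁻¹ (mirror (φ T))

private
  namesᵇ : BinaryTree → List ℕ
  namesᵇ (leaf tt)           = []
  namesᵇ (Binary.node l x r) = x ∷ namesᵇ l ++ namesᵇ r

  names-φ : ∀ ts → namesᵇ (φᶠ ts) ≡ namesᶠ ts
  names-φ []               = refl
  names-φ (node x cs ∷ ts) = cong₂ (λ a b → x ∷ a ++ b) (names-φ cs) (names-φ ts)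

  names-φ⁻¹ : ∀ B → namesᶠ (φᶠ⁻¹ B) ≡ namesᵇ B
  names-φ⁻¹ (leaf tt)           = refl
  names-φ⁻¹ (Binary.node l x r) = cong₂ (λ a b → x ∷ a ++ b) (names-φ⁻¹ l) (names-φ⁻¹ r)

  names-mirror : ∀ B → namesᵇ (mirror B) ↭ namesᵇ B
  names-mirror (leaf tt)           = ↭-refl
  names-mirror (Binary.node l x r) =
    prep x (↭-trans (++⁺ (names-mirror r) (names-mirror l)) (++-comm (namesᵇ r) (namesᵇ l)))

  names-φ̃ : ∀ T → rootName T ≡ 0 → names (φ̃-tree T) ↭ names T
  names-φ̃ (node .0 ts) refl =
    prep 0 (↭-trans (↭-reflexive (names-φ⁻¹ (mirror (φᶠ ts))))
           (↭-trans (names-mirror (φᶠ ts)) (↭-reflexive (names-φ ts))))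

  leftmost-φ̃ : ∀ T → head (map rootName (subtrees (φ̃-tree T))) ≡ head (map rootName (subtrees T))
  leftmost-φ̃ (node _ [])              = refl
  leftmost-φ̃ (node _ (node _ _ ∷ _)) = refl

φ̃ : ∀ {n} → 𝒫 n → 𝒫 n
φ̃ T .tree          = φ̃-tree (tree T)
φ̃ T .named         = ↭-trans (names-φ̃ (tree T) (root-is-0 T)) (named T)
φ̃ T .root-is-0     = refl
φ̃ T .leftmost-is-1 = trans (leftmost-φ̃ (tree T)) (leftmost-is-1 T)

------------------------------------------------------------------------
-- Complement and the relation ⇝

-- The leaves are the added nodes, `leaf v` being v′.
Complement : Set
Complement = Binary.Tree ℕ ℕ

-- `complete u B` adds nodes to a subtree B of φ T, where u is the parent in T
-- of the root of B if B is not absent, and u′ is the name of the node to be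
-- added if it is.  A left child in φ T has the same parent in T as in φ T,
-- whereas a right child is a sibling in T of its parent in φ T.  Hence a
-- missing left child of x is named x′, and a missing right child of x is named
-- u′ for u the parent of x in T.
complete : ℕ → BinaryTree → Complement
complete u (leaf tt)           = leaf u
complete u (Binary.node l x r) = Binary.node (complete x l) x (complete u r)

-- The complement of φ T.
complement : PlaneTree → Complement
complement T = complete (rootName T) (φ T)

-- `v ′rightChildOf u ∈ C`: in C, the added node v′ is the right child of u.
data _′rightChildOf_∈_ (v u : ℕ) : Complement → Set where
  here  : ∀ {l} → v ′rightChildOf u ∈ Binary.node l u (leaf v)
  left  : ∀ {l x r} → v ′rightChildOf u ∈ l → v ′rightChildOf u ∈ Binary.node l x r
  right : ∀ {l x r} → v ′rightChildOf u ∈ r → v ′rightChildOf u ∈ Binary.node l x r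

_⊢_⇝_ : ∀ {n} → 𝒫 n → ℕ → ℕ → Set
T ⊢ v ⇝ u = v ′rightChildOf u ∈ complement (tree T)
          ⊎ u ′rightChildOf v ∈ complement (tree (φ̃ T))

------------------------------------------------------------------------
-- Nodes of a plane tree and their statistics

-- A node is given by its position, the sequence of choices of a child leading
-- to it from the root.
data Node : PlaneTree → Set where
  root  : ∀ {x ts} → Node (node x ts)
  below : ∀ {x ts} (i : Fin (length ts)) → Node (lookup ts i) → Node (node x ts)

-- Sets of nodes are given as lists of the subtrees rooted at those nodes.
subtree : ∀ {T} → Node T → PlaneTree
subtree {T} root    = T
subtree (below _ v) = subtree v

name : ∀ {T} → Node T → ℕ
name v = rootName (subtree v)

Ch : ∀ {T} → Node T → List PlaneTree
Ch v = subtrees (subtree v)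

record Siblings : Set where
  constructor siblings
  field
    elder younger : List PlaneTree

open Siblings public

-- The non-root nodes on the path from v to the root, starting at v, each
-- represented by its siblings.
path : ∀ {T} → Node T → List Siblings
path root                    = []
path {node _ ts} (below i v) = path v ∷ʳ siblings (take (toℕ i) ts) (drop (suc (toℕ i)) ts)

lev : ∀ {T} → Node T → ℕ
lev v = length (path v)

Lc : ∀ {T} → Node T → List PlaneTree
Lc v = concatMap elder (path v)

lsw : ∀ {T} → Node T → ℕ
lsw v = length (Ch v) + length (Lc v)

rsw : ∀ {T} → Node T → ℕ
rsw v = length (Ch v) + length (concatMap younger (path v))

-- The lchain of the node at which the given subtree is rooted; this depends
-- only on the subtree.
lchain : PlaneTree → ℕ
lchain (node _ [])      = 0
lchain (node _ (t ∷ _)) = suc (lchain t)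

-- The number of nodes up to and including the first one having elder siblings.
-- If there is none, every node but the root is counted, which gives the level.
upToElder : List Siblings → ℕ
upToElder []                       = 0
upToElder (siblings [] _ ∷ ss)      = suc (upToElder ss)
upToElder (siblings (_ ∷ _) _ ∷ _)  = 1

d̃eg : ∀ {T} → Node T → ℕ
d̃eg v with Ch v
... | []    = upToElder (path v)
... | _ ∷ _ = 0

r̃sw : ∀ {T} → Node T → ℕ
r̃sw v = sum (map lchain (Lc v ++ Ch v)) + d̃eg v

{-# OPTIONS --safe #-}
module Submission where

-- Since φ̃ is an involution and all four equations are symmetric under exchanging
-- (T , v) with (φ̃ T , u), it suffices to treat the case in which v′ is the right
-- child of u in the complement of φ T: then u is the youngest child of v in T,
-- hence a leaf of φ̃ T.  Mirroring exchanges steps to the eldest child with steps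
-- to the next sibling, so the path of u in φ̃ T consists of Lc v ∪ Ch v, whereas
-- Lc u in φ̃ T consists of the non-root nodes on the path of v in T; moreover the
-- lchain of a node in either tree is the number of its younger siblings in the other.
-- Finally d̃eg u in φ̃ T is the number of children of v.

open import Defs
open import Data.Fin using (zero; suc)
open import Data.List using (List; []; _∷_; _++_; _∷ʳ_; map; concatMap; length; lookup)
open import Data.List.Membership.Propositional using (_∈_)
open import Data.List.Membership.Propositional.Properties using (∈-++⁺ˡ; ∈-++⁺ʳ)
open import Data.List.Properties using (length-++; map-++; concatMap-++; ++-identityʳ)
open import Data.List.Relation.Binary.Permutation.Propositional using (↭-sym; ↭⇒↭ₛ)
open import Data.List.Relation.Binary.Permutation.Setoid.Properties using (Unique-resp-↭)
open import Data.List.Relation.Unary.All as All using (All; []; _∷_)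
open import Data.List.Relation.Unary.All.Properties using (++⁻ˡ; ++⁻ʳ)
open import Data.List.Relation.Unary.AllPairs using (AllPairs; []; _∷_)
open import Data.List.Relation.Unary.Any using (here; there)
open import Data.List.Relation.Unary.Unique.Propositional using (Unique)
open import Data.List.Relation.Unary.Unique.Propositional.Properties using (upTo⁺)
open import Data.Nat using (ℕ; suc; _+_; _≤_; _<_; z<s)
open import Data.Nat.ListAction using (sum)
open import Data.Nat.ListAction.Properties using (sum-++)
open import Data.Nat.Properties using (+-assoc; +-comm; +-identityʳ; +-suc; m≤n⇒m≤n+o)
open import Data.Nat.Tactic.RingSolver using (solve-∀)
open import Data.Product using (Σ-syntax; _×_; _,_; _,′_)
open import Data.Sum using (inj₁; inj₂)
open import Data.Tree.Binary as Binary using (leaf)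
open import Data.Unit using (tt)
open import Function using (_∘_)
open import Level using (Level)
open import Relation.Binary.Core using (Rel)
open import Relation.Binary.PropositionalEquality
  using (_≡_; refl; sym; trans; cong; cong₂; subst; setoid; module ≡-Reasoning)
open import Relation.Nullary using (contradiction)

open ≡-Reasoning

private
  variable
    a ℓ : Level
    A : Set a
    x v u : ℕ
    t T T′ : PlaneTree
    ts e f g C : List PlaneTree
    P Q : List Siblings

-- Names determine nodes

AllPairs-++⁻ : ∀ {R : Rel A ℓ} xs {ys} → AllPairs R (xs ++ ys) →
  AllPairs R xs × AllPairs R ys × All (λ x → All (R x) ys) xs
AllPairs-++⁻ []       Rys        = [] , Rys , []
AllPairs-++⁻ (x ∷ xs) (Rx ∷ Rxs) with AllPairs-++⁻ xs Rxs
... | Rxs′ , Rys , Rxys = ++⁻ˡ xs Rx ∷ Rxs′ , Rys , ++⁻ʳ xs Rx ∷ Rxys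

-- Acts on whole nodes so that `cong` can shift `below i v ≡ below j w` past `t`; for distinct
-- indices `v` and `w` have different types and cannot be equated directly.
prepend : ∀ t → Node (node x ts) → Node (node x (t ∷ ts))
prepend t root        = root
prepend t (below i v) = below (suc i) v

mutual
  name∈names : (v : Node T) → name v ∈ names T
  name∈names root                  = here refl
  name∈names (below {ts = ts} i v) = there (name∈namesᶠ ts i v)

  name∈namesᶠ : ∀ ts i (v : Node (lookup ts i)) → name v ∈ namesᶠ ts
  name∈namesᶠ (t ∷ ts) zero    v = ∈-++⁺ˡ (name∈names v)
  name∈namesᶠ (t ∷ ts) (suc i) v = ∈-++⁺ʳ (names t) (name∈namesᶠ ts i v)

mutual
  -- The relation `⇝` sees only names, so this is what identifies nodes found by induction with the
  -- given ones. Distinct children have disjoint names, so equal names force the same child at every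
  -- step.
  name-injective : Unique (names T) → (v w : Node T) → name v ≡ name w → v ≡ w
  name-injective _ root root _ = refl
  name-injective (x∉ ∷ _) root (below {ts = ts} i w) eq =
    contradiction eq (All.lookup x∉ (name∈namesᶠ ts i w))
  name-injective (x∉ ∷ _) (below {ts = ts} i v) root eq =
    contradiction (sym eq) (All.lookup x∉ (name∈namesᶠ ts i v))
  name-injective (_ ∷ uniq) (below {ts = ts} i v) (below j w) eq = below-injective ts uniq i j v w eq

  below-injective : ∀ ts → Unique (namesᶠ ts) →
    ∀ i j (v : Node (lookup ts i)) (w : Node (lookup ts j)) →
    name v ≡ name w → below {x} i v ≡ below j w
  below-injective (t ∷ ts) uniq zero zero v w eq with AllPairs-++⁻ (names t) uniq
  ... | uniqₜ , _ , _ = cong (below zero) (name-injective uniqₜ v w eq)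
  below-injective (t ∷ ts) uniq zero (suc j) v w eq with AllPairs-++⁻ (names t) uniq
  ... | _ , _ , disj =
    contradiction eq (All.lookup (All.lookup disj (name∈names v)) (name∈namesᶠ ts j w))
  below-injective (t ∷ ts) uniq (suc i) zero v w eq with AllPairs-++⁻ (names t) uniq
  ... | _ , _ , disj =
    contradiction (sym eq) (All.lookup (All.lookup disj (name∈names w)) (name∈namesᶠ ts i v))
  below-injective (t ∷ ts) uniq (suc i) (suc j) v w eq with AllPairs-++⁻ (names t) uniq
  ... | _ , uniqₜₛ , _ = cong (prepend t) (below-injective ts uniqₜₛ i j v w eq)

names-unique : ∀ {n} (T : 𝒫 n) → Unique (names (tree T))
names-unique {n} T = Unique-resp-↭ (setoid ℕ) (↭⇒↭ₛ (↭-sym (named T))) (upTo⁺ (suc n))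

-- The involution

mirror-involutive : ∀ B → mirror (mirror B) ≡ B
mirror-involutive (leaf tt)           = refl
mirror-involutive (Binary.node l x r) =
  cong₂ (λ l r → Binary.node l x r) (mirror-involutive l) (mirror-involutive r)

φ̃-tree-involutive : ∀ T → rootName T ≡ 0 → φ̃-tree (φ̃-tree T) ≡ T
φ̃-tree-involutive T T₀ = begin
  φ⁻¹ (mirror (φ (φ⁻¹ (mirror (φ T))))) ≡⟨ cong (φ⁻¹ ∘ mirror) (φ∘φ⁻¹ (mirror (φ T))) ⟩
  φ⁻¹ (mirror (mirror (φ T)))           ≡⟨ cong φ⁻¹ (mirror-involutive (φ T)) ⟩
  φ⁻¹ (φ T)                             ≡⟨ φ⁻¹∘φ T T₀ ⟩
  T                                     ∎

-- Forest form of the involution. By computation `φ̃ᶠ (node y cs ∷ ts)` is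
-- `node y (φ̃ᶠ ts) ∷ φ̃ᶠ cs`: children and younger siblings of `y` trade places.
φ̃ᶠ : List PlaneTree → List PlaneTree
φ̃ᶠ ts = φᶠ⁻¹ (mirror (φᶠ ts))

-- Each tree of `ts` becomes the eldest child of its predecessor, so the left chain of the image
-- runs along `ts`.
lchain-φ̃ᶠ : ∀ ts → lchain (node x (φ̃ᶠ ts)) ≡ length ts
lchain-φ̃ᶠ []               = refl
lchain-φ̃ᶠ (node _ _ ∷ ts) = cong suc (lchain-φ̃ᶠ ts)

-- Conversely, an eldest child becomes the next sibling of its parent.
length-φ̃ᶠ : ∀ ts → lchain (node x ts) ≡ length (φ̃ᶠ ts)
length-φ̃ᶠ []                = refl
length-φ̃ᶠ (node _ ts ∷ _) = cong suc (length-φ̃ᶠ ts)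

-- Duality of paths

chains : List PlaneTree → ℕ
chains ts = sum (map lchain ts)

chains-++ : ∀ ts us → chains (ts ++ us) ≡ chains ts + chains us
chains-++ ts us = trans (cong sum (map-++ lchain ts us)) (sum-++ (map lchain ts) (map lchain us))

concatMap-∷ʳ : ∀ (h : Siblings → List PlaneTree) P s → concatMap h (P ∷ʳ s) ≡ concatMap h P ++ h s
concatMap-∷ʳ h P s = trans (concatMap-++ h P (s ∷ [])) (cong (concatMap h P ++_) (++-identityʳ (h s)))

length-∷ʳ : ∀ P (s : Siblings) → length (P ∷ʳ s) ≡ suc (length P)
length-∷ʳ P s = trans (length-++ P) (+-comm (length P) 1)

length-concatMap-∷ʳ : ∀ (h : Siblings → List PlaneTree) P s →
  length (concatMap h (P ∷ʳ s)) ≡ length (concatMap h P) + length (h s)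
length-concatMap-∷ʳ h P s = trans (cong length (concatMap-∷ʳ h P s)) (length-++ (concatMap h P))

chains-concatMap-∷ʳ : ∀ (h : Siblings → List PlaneTree) P s →
  chains (concatMap h (P ∷ʳ s)) ≡ chains (concatMap h P) + chains (h s)
chains-concatMap-∷ʳ h P s = trans (cong chains (concatMap-∷ʳ h P s)) (chains-++ (concatMap h P) (h s))

-- A walk that reaches the last entry counts it once, whether it stops there at an elder sibling or
-- for lack of further nodes.
upToElder-∷ʳ : ∀ P s s′ → upToElder (P ∷ʳ s) ≡ upToElder (P ∷ʳ s′)
upToElder-∷ʳ []                        (siblings [] _)      (siblings [] _)      = refl
upToElder-∷ʳ []                        (siblings [] _)      (siblings (_ ∷ _) _) = refl
upToElder-∷ʳ []                        (siblings (_ ∷ _) _) (siblings [] _)      = refl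
upToElder-∷ʳ []                        (siblings (_ ∷ _) _) (siblings (_ ∷ _) _) = refl
upToElder-∷ʳ (siblings [] _ ∷ P)       s                    s′ = cong suc (upToElder-∷ʳ P s s′)
upToElder-∷ʳ (siblings (_ ∷ _) _ ∷ P) s                    s′ = refl

-- No entry of `P` has elder siblings, so the walk passes through to `s`.
upToElder-∷ʳ-suc : ∀ P s → 0 ≡ length (concatMap elder P) → upToElder (P ∷ʳ s) ≡ suc (upToElder P)
upToElder-∷ʳ-suc []                       (siblings [] _)      _  = refl
upToElder-∷ʳ-suc []                       (siblings (_ ∷ _) _) _  = refl
upToElder-∷ʳ-suc (siblings [] _ ∷ P)      s                    eq = cong suc (upToElder-∷ʳ-suc P s eq)

-- Some entry of `P` has elder siblings, so the walk ends before `s`.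
upToElder-∷ʳ-id : ∀ {n} P s → suc n ≡ length (concatMap elder P) → upToElder (P ∷ʳ s) ≡ upToElder P
upToElder-∷ʳ-id (siblings [] _ ∷ P)      s eq = cong suc (upToElder-∷ʳ-id P s eq)
upToElder-∷ʳ-id (siblings (_ ∷ _) _ ∷ _) s _  = refl

-- C and P are the children and the path of v, Q is the path of a leaf u.
record Dual (C : List PlaneTree) (P Q : List Siblings) : Set where
  field
    lsw-lev  : length C + length (concatMap elder P) ≡ length Q
    lev-lsw  : length P ≡ length (concatMap elder Q)
    rsw-r̃sw : length C + length (concatMap younger P) ≡ chains (concatMap elder Q) + upToElder Q
    r̃sw-rsw : chains (concatMap elder P) + chains C ≡ length (concatMap younger Q)

open Dual

-- The path of `v` is extended by an eldest child with younger siblings `f`. In the image this child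
-- is `t`, which joins the elder siblings in the last entry of the path of `u`; its chain accounts
-- for `f`.
dual-left : lchain t ≡ length f →
  Dual C P (Q ∷ʳ siblings e g) → Dual C (P ∷ʳ siblings [] f) (Q ∷ʳ siblings (t ∷ e) g)
dual-left {t} {f} {C} {P} {Q} {e} {g} eq d = record
  { lsw-lev = begin
      c + length (concatMap elder (P ∷ʳ s))
        ≡⟨ cong (c +_) (trans (length-concatMap-∷ʳ elder P s) (+-identityʳ _)) ⟩
      c + length (concatMap elder P)
        ≡⟨ lsw-lev d ⟩
      length (Q ∷ʳ r)
        ≡⟨ trans (length-∷ʳ Q r) (sym (length-∷ʳ Q r⁺)) ⟩
      length (Q ∷ʳ r⁺) ∎
  ; lev-lsw = begin
      length (P ∷ʳ s)
        ≡⟨ length-∷ʳ P s ⟩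
      suc (length P)
        ≡⟨ cong suc (trans (lev-lsw d) (length-concatMap-∷ʳ elder Q r)) ⟩
      suc (length (concatMap elder Q) + length e)
        ≡⟨ trans (length-concatMap-∷ʳ elder Q r⁺) (+-suc _ _) ⟨
      length (concatMap elder (Q ∷ʳ r⁺)) ∎
  ; rsw-r̃sw = begin
      c + length (concatMap younger (P ∷ʳ s))
        ≡⟨ cong (c +_) (length-concatMap-∷ʳ younger P s) ⟩
      c + (length (concatMap younger P) + length f)
        ≡⟨ +-assoc c _ _ ⟨
      c + length (concatMap younger P) + length f
        ≡⟨ cong₂ _+_ (rsw-r̃sw d) (sym eq) ⟩
      chains (concatMap elder (Q ∷ʳ r)) + upToElder (Q ∷ʳ r) + lchain t
        ≡⟨ cong₂ (λ m n → m + n + lchain t) (chains-concatMap-∷ʳ elder Q r) (upToElder-∷ʳ Q r r⁺) ⟩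
      chains (concatMap elder Q) + chains e + upToElder (Q ∷ʳ r⁺) + lchain t
        ≡⟨ reorder (chains (concatMap elder Q)) _ _ _ ⟩
      chains (concatMap elder Q) + chains (t ∷ e) + upToElder (Q ∷ʳ r⁺)
        ≡⟨ cong (_+ upToElder (Q ∷ʳ r⁺)) (chains-concatMap-∷ʳ elder Q r⁺) ⟨
      chains (concatMap elder (Q ∷ʳ r⁺)) + upToElder (Q ∷ʳ r⁺) ∎
  ; r̃sw-rsw = begin
      chains (concatMap elder (P ∷ʳ s)) + chains C
        ≡⟨ cong (_+ chains C) (trans (chains-concatMap-∷ʳ elder P s) (+-identityʳ _)) ⟩
      chains (concatMap elder P) + chains C
        ≡⟨ r̃sw-rsw d ⟩
      length (concatMap younger (Q ∷ʳ r))
        ≡⟨ trans (length-concatMap-∷ʳ younger Q r) (sym (length-concatMap-∷ʳ younger Q r⁺)) ⟩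
      length (concatMap younger (Q ∷ʳ r⁺)) ∎
  }
  where
  c = length C
  s = siblings [] f
  r = siblings e g
  r⁺ = siblings (t ∷ e) g
  reorder : ∀ a b c d → a + b + c + d ≡ a + (d + b) + c
  reorder = solve-∀

-- While the path of v is empty, no node on Q has an elder sibling, so the node
-- appended to Q counts towards d̃eg u; in dual-right-below it does not.
dual-right-root : lchain t ≡ length g → Dual C [] Q → Dual (t ∷ C) [] (Q ∷ʳ siblings [] g)
dual-right-root {t} {g} {C} {Q} eq d = record
  { lsw-lev = trans (cong suc (lsw-lev d)) (sym (length-∷ʳ Q r))
  ; lev-lsw = trans (lev-lsw d) (sym (trans (length-concatMap-∷ʳ elder Q r) (+-identityʳ _)))
  ; rsw-r̃sw = begin
      suc (length C + 0)
        ≡⟨ cong suc (rsw-r̃sw d) ⟩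
      suc (chains (concatMap elder Q) + upToElder Q)
        ≡⟨ +-suc _ _ ⟨
      chains (concatMap elder Q) + suc (upToElder Q)
        ≡⟨ cong₂ _+_ (trans (chains-concatMap-∷ʳ elder Q r) (+-identityʳ _))
                     (upToElder-∷ʳ-suc Q r (lev-lsw d)) ⟨
      chains (concatMap elder (Q ∷ʳ r)) + upToElder (Q ∷ʳ r) ∎
  ; r̃sw-rsw = begin
      lchain t + chains C
        ≡⟨ trans (+-comm (lchain t) _) (cong₂ _+_ (r̃sw-rsw d) eq) ⟩
      length (concatMap younger Q) + length g
        ≡⟨ length-concatMap-∷ʳ younger Q r ⟨
      length (concatMap younger (Q ∷ʳ r)) ∎
  }
  where r = siblings [] g

-- Here `t` is put to the left of the last entry on the path of `v`, and in the image its node is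
-- put on top of the path of `u`, with younger siblings `g` matching the chain of `t`. As the path
-- of `v` is nonempty, `lev-lsw` provides an elder sibling on `Q`.
dual-right-below : lchain t ≡ length g →
  Dual C (P ∷ʳ siblings e f) Q → Dual C (P ∷ʳ siblings (t ∷ e) f) (Q ∷ʳ siblings [] g)
dual-right-below {t} {g} {C} {P} {e} {f} {Q} eq d = record
  { lsw-lev = begin
      c + length (concatMap elder (P ∷ʳ s⁺))
        ≡⟨ cong (c +_) (trans (length-concatMap-∷ʳ elder P s⁺) (+-suc _ _)) ⟩
      c + suc (length (concatMap elder P) + length e)
        ≡⟨ +-suc c _ ⟩
      suc (c + (length (concatMap elder P) + length e))
        ≡⟨ cong (λ k → suc (c + k)) (length-concatMap-∷ʳ elder P s) ⟨
      suc (c + length (concatMap elder (P ∷ʳ s)))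
        ≡⟨ trans (cong suc (lsw-lev d)) (sym (length-∷ʳ Q r)) ⟩
      length (Q ∷ʳ r) ∎
  ; lev-lsw = begin
      length (P ∷ʳ s⁺)
        ≡⟨ trans (length-∷ʳ P s⁺) (sym (length-∷ʳ P s)) ⟩
      length (P ∷ʳ s)
        ≡⟨ lev-lsw d ⟩
      length (concatMap elder Q)
        ≡⟨ trans (length-concatMap-∷ʳ elder Q r) (+-identityʳ _) ⟨
      length (concatMap elder (Q ∷ʳ r)) ∎
  ; rsw-r̃sw = begin
      c + length (concatMap younger (P ∷ʳ s⁺))
        ≡⟨ cong (c +_) (trans (length-concatMap-∷ʳ younger P s⁺) (sym (length-concatMap-∷ʳ younger P s))) ⟩
      c + length (concatMap younger (P ∷ʳ s))
        ≡⟨ rsw-r̃sw d ⟩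
      chains (concatMap elder Q) + upToElder Q
        ≡⟨ cong₂ _+_ (trans (chains-concatMap-∷ʳ elder Q r) (+-identityʳ _))
                     (upToElder-∷ʳ-id Q r (trans (sym (length-∷ʳ P s)) (lev-lsw d))) ⟨
      chains (concatMap elder (Q ∷ʳ r)) + upToElder (Q ∷ʳ r) ∎
  ; r̃sw-rsw = begin
      chains (concatMap elder (P ∷ʳ s⁺)) + chains C
        ≡⟨ cong (_+ chains C) (chains-concatMap-∷ʳ elder P s⁺) ⟩
      chains (concatMap elder P) + (lchain t + chains e) + chains C
        ≡⟨ reorder (chains (concatMap elder P)) _ _ _ ⟩
      chains (concatMap elder P) + chains e + chains C + lchain t
        ≡⟨ cong₂ (λ m n → m + chains C + n) (sym (chains-concatMap-∷ʳ elder P s)) eq ⟩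
      chains (concatMap elder (P ∷ʳ s)) + chains C + length g
        ≡⟨ cong (_+ length g) (r̃sw-rsw d) ⟩
      length (concatMap younger Q) + length g
        ≡⟨ length-concatMap-∷ʳ younger Q r ⟨
      length (concatMap younger (Q ∷ʳ r)) ∎
  }
  where
  c = length C
  s = siblings e f
  s⁺ = siblings (t ∷ e) f
  r = siblings [] g
  reorder : ∀ a b c d → a + (b + c) + d ≡ a + c + d + b
  reorder = solve-∀

-- Construction of dual nodes

-- The first two fields decide the dual degrees: zero at `v`, `upToElder` of the path at `u`. The
-- first also keeps `u` from being a root.
record DualNodes (v : Node T) (u : Node T′) : Set where
  field
    internal : 0 < length (Ch v)
    isLeaf   : Ch u ≡ []
    dual     : Dual (Ch v) (path v) (path u)

open DualNodes

-- Induction on the position of the added node. The names `p` and `q` are those of the parents of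
-- the forest and of its image; a step to the left replaces `p` by `y`, a step to the right replaces
-- `q`.
dual-nodes : ∀ p q ts → v ′rightChildOf u ∈ complete p (φᶠ ts) →
  Σ[ v₀ ∈ Node (node p ts) ] Σ[ u₀ ∈ Node (node q (φ̃ᶠ ts)) ]
    name v₀ ≡ v × name u₀ ≡ u × DualNodes v₀ u₀
dual-nodes p q (node y cs ∷ ts@(node _ _ ∷ _)) (right d) with dual-nodes p y ts d
... | root , u₀ , v≡ , u≡ , D = root , below zero u₀ , v≡ , u≡ , record
  { internal = z<s
  ; isLeaf   = isLeaf D
  ; dual     = dual-right-root (length-φ̃ᶠ cs) (dual D)
  }
... | below i w , u₀ , v≡ , u≡ , D = below (suc i) w , below zero u₀ , v≡ , u≡ , record
  { internal = internal D
  ; isLeaf   = isLeaf D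
  ; dual     = dual-right-below (length-φ̃ᶠ cs) (dual D)
  }
-- Without younger siblings, `y` becomes a leaf of the image; its younger siblings there are
-- `φ̃ᶠ cs`.
dual-nodes p q (node y cs ∷ []) here = root , below zero root , refl , refl , record
  { internal = z<s
  ; isLeaf   = refl
  ; dual     = record
    { lsw-lev  = refl
    ; lev-lsw  = refl
    ; rsw-r̃sw = refl
    ; r̃sw-rsw = trans (+-identityʳ _)
        (trans (length-φ̃ᶠ cs) (cong length (sym (++-identityʳ (φ̃ᶠ cs)))))
    }
  }
dual-nodes p q (node y cs ∷ ts) (left d) with dual-nodes y q cs d
-- The level of `u₀` is the `lsw` of `v₀`, which is positive since `v₀` has children.
... | v₀ , root , _ , _ , D = contradiction (subst (0 <_) (lsw-lev (dual D)) (m≤n⇒m≤n+o _ (internal D))) λ ()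
... | v₀ , below i w , v≡ , u≡ , D = below zero v₀ , below (suc i) w , v≡ , u≡ , record
  { internal = internal D
  ; isLeaf   = isLeaf D
  ; dual     = dual-left (lchain-φ̃ᶠ ts) (dual D)
  }

-- Transfer to the statistics

d̃eg-internal : (v : Node T) → 0 < length (Ch v) → d̃eg v ≡ 0
d̃eg-internal v 0<Ch with Ch v
... | _ ∷ _ = refl

d̃eg-leaf : (u : Node T) → Ch u ≡ [] → d̃eg u ≡ upToElder (path u)
d̃eg-leaf u Ch≡[] with Ch u
... | [] = refl

dual-statistics : (v : Node T) (u : Node T′) → DualNodes v u →
  lsw v ≡ lev u × lev v ≡ lsw u × rsw v ≡ r̃sw u × r̃sw v ≡ rsw u
dual-statistics v u D = lsw-lev δ
  , trans (lev-lsw δ) (cong (λ C → length C + length (Lc u)) (sym (isLeaf D)))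
  , (begin
      rsw v                                   ≡⟨ rsw-r̃sw δ ⟩
      chains (Lc u) + upToElder (path u)      ≡⟨ cong₂ (λ ts d → chains ts + d) (++-identityʳ (Lc u)) (d̃eg-leaf u (isLeaf D)) ⟨
      chains (Lc u ++ []) + d̃eg u            ≡⟨ cong (λ C → chains (Lc u ++ C) + d̃eg u) (isLeaf D) ⟨
      r̃sw u                                  ∎)
  , (begin
      chains (Lc v ++ Ch v) + d̃eg v          ≡⟨ cong₂ _+_ (chains-++ (Lc v) (Ch v)) (d̃eg-internal v (internal D)) ⟩
      chains (Lc v) + chains (Ch v) + 0       ≡⟨ trans (+-identityʳ _) (r̃sw-rsw δ) ⟩
      length (concatMap younger (path u))     ≡⟨ cong (λ C → length C + length (concatMap younger (path u))) (isLeaf D) ⟨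
      rsw u                                   ∎)
  where δ = dual D

-- `T′` is tied to `T` by an equation so that the two trees can also be used in exchanged roles,
-- where involutivity supplies the equation.
rightChild-statistics : T′ ≡ φ̃-tree T → Unique (names T) → Unique (names T′) →
  (v : Node T) (u : Node T′) → name v ′rightChildOf name u ∈ complement T →
  lsw v ≡ lev u × lev v ≡ lsw u × rsw v ≡ r̃sw u × r̃sw v ≡ rsw u
-- The `0` is the root name that `φ⁻¹` assigns.
rightChild-statistics {T = node p ts} refl T! T′! v u d with dual-nodes p 0 ts d
... | v₀ , u₀ , v≡ , u≡ , D
  with refl ← name-injective T! v₀ v v≡ | refl ← name-injective T′! u₀ u u≡ = dual-statistics v₀ u₀ D

theorem2p14 : (n : ℕ) → 1 ≤ n → (T : 𝒫 n) →
    (v : Node (tree T)) (u : Node (tree (φ̃ T))) →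
    T ⊢ name v ⇝ name u →
    (lsw v ,′ lev v ,′ rsw v ,′ r̃sw v) ≡ (lev u ,′ lsw u ,′ r̃sw u ,′ rsw u)
theorem2p14 n _ T v u (inj₁ d)
  with lsw≡ , lev≡ , rsw≡ , r̃sw≡ ←
         rightChild-statistics refl (names-unique T) (names-unique (φ̃ T)) v u d
  = cong₂ _,′_ lsw≡ (cong₂ _,′_ lev≡ (cong₂ _,′_ rsw≡ r̃sw≡))
theorem2p14 n _ T v u (inj₂ d)
  with lsw≡ , lev≡ , rsw≡ , r̃sw≡ ←
         rightChild-statistics (sym (φ̃-tree-involutive (tree T) (root-is-0 T)))
           (names-unique (φ̃ T)) (names-unique T) u v d
  -- With `u` and `v` exchanged, each equation is reversed and swaps places with its partner.
  = cong₂ _,′_ (sym lev≡) (cong₂ _,′_ (sym lsw≡) (cong₂ _,′_ (sym r̃sw≡) (sym rsw≡)))
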